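{- If $G$ is a graph on $n \geq 2$ vertices, then (i) $2 \lceil \frac{n}{2} \rceil \leq \gamma_{ir}(G) + \gamma_{ir}(\bar{G}) \leq 2n-1$, (ii) $\left( \lceil \frac{n}{2} \rceil \right)^2 \leq \gamma_{ir}(G)\, \gamma_{ir}(\bar{G}) \leq n(n-1)$. Moreover, the following hold: (a) The bounds are attainable for any $n \geq 3$: for every integer $n \geq 3$ and each of the lower and upper bounds in (i) and (ii), there is a graph $G$ on $n$ vertices for which equality holds. (b) For each of (i) and (ii), the upper bound is attained if and only if $G$ is empty (has no edges) or complete.
   Context: All graphs are finite, simple and undirected. $\bar{G}$ denotes the complement of $G$. $N(v)$ denotes the set of neighbours of a vertex $v$. A dominating set of $G$ is a set $D \subseteq V(G)$ such that every vertex in $V(G)\setminus D$ has a neighbour in $D$. An irregular dominating set of $G$ is a dominating set $D$ of $G$ such that $|N(u) \cap D| \neq |N(v) \cap D|$ for every two distinct vertices $u, v \in V(G) \setminus D$ (in particular, $V(G)$ is one). The irregular domination number $\gamma_{ir}(G)$ is the size of a smallest irregular dominating set of $G$. -}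

module Defs where

open import Data.Fin.Base using (Fin)
open import Data.Fin.Properties using (_≟_; any?; all?)
open import Data.Fin.Subset using (Subset; _∈_; _∉_; _∩_; ⊤; ∣_∣)
open import Data.Fin.Subset.Properties using (_∈?_; ∈⊤; ∣⊤∣≡n; anySubset?)
open import Data.Nat.Base using (ℕ; zero; suc; _≤_; z≤n; s≤s)
import Data.Nat.Properties as ℕ
open import Data.Product.Base using (∃; _×_; _,_; proj₁; proj₂)
open import Data.Vec.Base using (tabulate)
open import Function.Base using (_∘_)
open import Level using (0ℓ)
open import Relation.Binary.Core using (Rel)
import Relation.Binary.Definitions as B
open import Relation.Binary.PropositionalEquality
  using (_≡_; _≢_; refl; sym)
open import Relation.Nullary using (¬_; yes; no; does; contradiction)
open import Relation.Nullary.Decidable using (¬?; _×-dec_; _→-dec_)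
open import Relation.Unary using (Pred; Decidable)

-- Finite simple undirected graphs, with vertex set Fin n.  Adjacency is
-- decidable, so that neighbourhoods are finite sets with a cardinality.
record Graph (n : ℕ) : Set₁ where
  field
    Adj        : Rel (Fin n) 0ℓ
    adj?       : B.Decidable Adj
    adj-sym    : B.Symmetric Adj
    adj-irrefl : ∀ v → ¬ Adj v v

open Graph public

complement : ∀ {n} → Graph n → Graph n
complement G = record
  { Adj        = λ u v → u ≢ v × ¬ Adj G u v
  ; adj?       = λ u v → ¬? (u ≟ v) ×-dec ¬? (adj? G u v)
  ; adj-sym    = λ (u≢v , ¬uv) → u≢v ∘ sym , ¬uv ∘ adj-sym G
  ; adj-irrefl = λ v (v≢v , _) → v≢v refl
  }

IsEmpty : ∀ {n} → Graph n → Set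
IsEmpty G = ∀ u v → ¬ Adj G u v

IsComplete : ∀ {n} → Graph n → Set
IsComplete G = ∀ u v → u ≢ v → Adj G u v

N : ∀ {n} → Graph n → Fin n → Subset n
N G v = tabulate (λ u → does (adj? G v u))

Dominating : ∀ {n} → Graph n → Pred (Subset n) 0ℓ
Dominating G D = ∀ v → v ∉ D → ∃ λ u → u ∈ D × Adj G v u

IrregularDominating : ∀ {n} → Graph n → Pred (Subset n) 0ℓ
IrregularDominating G D =
  Dominating G D ×
  (∀ u v → u ∉ D → v ∉ D → u ≢ v → ∣ N G u ∩ D ∣ ≢ ∣ N G v ∩ D ∣)

irregularDominating? : ∀ {n} (G : Graph n) → Decidable (IrregularDominating G)
irregularDominating? G D =
  all? (λ v → ¬? (v ∈? D) →-dec any? (λ u → (u ∈? D) ×-dec adj? G v u))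
  ×-dec
  all? (λ u → all? (λ v →
    ¬? (u ∈? D) →-dec (¬? (v ∈? D) →-dec (¬? (u ≟ v) →-dec
      ¬? (∣ N G u ∩ D ∣ ℕ.≟ ∣ N G v ∩ D ∣)))))

⊤-irregularDominating : ∀ {n} (G : Graph n) → IrregularDominating G ⊤
⊤-irregularDominating G =
  (λ v v∉⊤ → contradiction ∈⊤ v∉⊤) , (λ u v u∉⊤ → contradiction ∈⊤ u∉⊤)

HasIrregularDominatingSetOfSize : ∀ {n} → Graph n → Pred ℕ 0ℓ
HasIrregularDominatingSetOfSize G k =
  ∃ λ D → IrregularDominating G D × ∣ D ∣ ≡ k

IsLeast : Pred ℕ 0ℓ → Pred ℕ 0ℓ
IsLeast P k = P k × (∀ j → P j → k ≤ j)

least : ∀ {P : Pred ℕ 0ℓ} → Decidable P → ∀ m → P m → ∃ (IsLeast P)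
least P? zero    p = zero , p , λ _ _ → z≤n
least {P} P? (suc m) p with P? zero
... | yes p₀ = zero , p₀ , λ _ _ → z≤n
... | no ¬p₀ with least (P? ∘ suc) m p
...   | k , pk , k-min = suc k , pk , λ where
          zero    p₀ → contradiction p₀ ¬p₀
          (suc j) pj → s≤s (k-min j pj)

leastIrregularDominatingSize : ∀ {n} (G : Graph n) →
  ∃ (IsLeast (HasIrregularDominatingSetOfSize G))
leastIrregularDominatingSize {n} G =
  least
    (λ k → anySubset? (λ D → irregularDominating? G D ×-dec (∣ D ∣ ℕ.≟ k)))
    n (⊤ , ⊤-irregularDominating G , ∣⊤∣≡n n)

γir : ∀ {n} → Graph n → ℕ
γir G = proj₁ (leastIrregularDominatingSize G)

γir-isLeast : ∀ {n} (G : Graph n) →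
  IsLeast (HasIrregularDominatingSetOfSize G) (γir G)
γir-isLeast G = proj₂ (leastIrregularDominatingSize G)

-- Upper bounds: γir G = n exactly when G is empty, because the complement of an
-- end of an edge is irregular dominating; and γir Kₙ = n - 1.  So unless G is
-- empty or complete, both γir G and γir Ḡ are at most n - 1.
-- Lower bounds: γir ≥ ⌈n/2⌉ by pigeonhole on the degrees into D.
-- For sharpness, irregularity is obtained by making the neighbourhoods in D
-- of the outside vertices a strict chain, so that no degree is computed.
module Submission where

open import Defs
import Data.Empty as Empty
open import Data.Fin.Base using (Fin; zero; suc; toℕ; fromℕ<)
open import Data.Fin.Properties as Fin
  using (_≟_; any?; toℕ<n; toℕ-injective; toℕ-fromℕ<)
open import Data.Fin.Subset
  using (Subset; inside; outside; ⊤; ⊥; _∈_; _∉_; _∩_; ∁; ⁅_⁆; ∣_∣)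
open import Data.Fin.Subset.Properties
  using (_∈?_; x∈p∩q⁺; x∈p∩q⁻; x∈⁅y⁆⇒x≡y;
         x∈∁p⇒x∉p; x∉∁p⇒x∈p; x∉p⇒x∈∁p; x≢y⇒x∉⁅y⁆;
         ∣p∣≤n; ∣⊥∣≡0; ∣⊤∣≡n; ∣⁅x⁆∣≡1; ∣∁p∣≡n∸∣p∣; ∣p∩q∣≤∣q∣;
         p⊆q⇒∣p∣≤∣q∣; p⊂q⇒∣p∣<∣q∣)
open import Data.Nat.Base
  using (ℕ; zero; suc; pred; _+_; _*_; _∸_; _^_; _≤_; _<_; z≤n; s≤s; s≤s⁻¹;
         ⌈_/2⌉; >-nonZero)
open import Data.Nat.Properties as ℕ hiding (_≟_)
open import Data.Product.Base using (Σ; ∃; _×_; _,_; proj₁; proj₂)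
open import Data.Sum.Base using (_⊎_; inj₁; inj₂; [_,_]′)
open import Data.Vec.Base using (_∷_; here; there; tabulate; _[_]≔_)
open import Data.Vec.Properties using (lookup∘tabulate; []=⇒lookup; lookup⇒[]=)
open import Function.Base using (_∘_; id; const)
open import Function.Bundles using (_⇔_; mk⇔)
open import Level using (0ℓ)
open import Relation.Binary.Definitions using (tri<; tri≈; tri>)
open import Relation.Binary.PropositionalEquality
open import Relation.Nullary using (¬_; yes; no; does; contradiction)
open import Relation.Nullary.Decidable
  using (¬?; _×-dec_; dec-true; decidable-stable)
open import Relation.Unary using (Pred; Decidable)

private
  variable
    n : ℕ

-- Subsets of `Fin n` and counting by pigeonhole.

⟦_⟧ : {P : Pred (Fin n) 0ℓ} → Decidable P → Subset n
⟦ P? ⟧ = tabulate (does ∘ P?)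

∈⟦⟧⁺ : {P : Pred (Fin n) 0ℓ} (P? : Decidable P) → ∀ {v} → P v → v ∈ ⟦ P? ⟧
∈⟦⟧⁺ P? {v} pv =
  lookup⇒[]= v _ (trans (lookup∘tabulate _ v) (dec-true (P? v) pv))

∈⟦⟧⁻ : {P : Pred (Fin n) 0ℓ} (P? : Decidable P) → ∀ {v} → v ∈ ⟦ P? ⟧ → P v
∈⟦⟧⁻ P? {v} v∈ with P? v | trans (sym (lookup∘tabulate (does ∘ P?) v)) ([]=⇒lookup v∈)
... | yes pv | _ = pv
... | no _   | ()

∣p∣≤1+∣p[x]≔outside∣ : (p : Subset n) (x : Fin n) →
  ∣ p ∣ ≤ suc ∣ p [ x ]≔ outside ∣
∣p∣≤1+∣p[x]≔outside∣ (inside  ∷ p) zero    = ≤-refl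
∣p∣≤1+∣p[x]≔outside∣ (outside ∷ p) zero    = n≤1+n _
∣p∣≤1+∣p[x]≔outside∣ (inside  ∷ p) (suc x) = s≤s (∣p∣≤1+∣p[x]≔outside∣ p x)
∣p∣≤1+∣p[x]≔outside∣ (outside ∷ p) (suc x) = ∣p∣≤1+∣p[x]≔outside∣ p x

∈[]≔outside⁻ : (p : Subset n) (x : Fin n) {y : Fin n} →
  y ∈ p [ x ]≔ outside → y ∈ p × y ≢ x
∈[]≔outside⁻ (_ ∷ p) zero    (there y∈) = there y∈ , λ ()
∈[]≔outside⁻ (_ ∷ p) (suc x) here       = here , λ ()
∈[]≔outside⁻ (_ ∷ p) (suc x) (there y∈) =
  let y∈p , y≢x = ∈[]≔outside⁻ p x y∈ in there y∈p , y≢x ∘ Fin.suc-injective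

-- Pigeonhole, by induction on the number of values: at most one element of `p` attains the largest
-- value, and removing it leaves one value fewer.
injectiveOn⇒∣p∣≤ : ∀ m (p : Subset n) (f : Fin n → ℕ) →
  (∀ {v} → v ∈ p → f v < m) →
  (∀ {u v} → u ∈ p → v ∈ p → f u ≡ f v → u ≡ v) → ∣ p ∣ ≤ m
injectiveOn⇒∣p∣≤ {n} zero p f f< inj = ≤-trans
  (p⊆q⇒∣p∣≤∣q∣ {q = ⊥} λ v∈ → contradiction (f< v∈) λ ())
  (≤-reflexive (∣⊥∣≡0 n))
injectiveOn⇒∣p∣≤ (suc m) p f f< inj
  with any? (λ v → (v ∈? p) ×-dec (f v ℕ.≟ m))
... | yes (x , x∈ , fx≡m) = ≤-trans (∣p∣≤1+∣p[x]≔outside∣ p x)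
  (s≤s (injectiveOn⇒∣p∣≤ m (p [ x ]≔ outside) f
    (λ v∈ → let v∈p , v≢x = ∈[]≔outside⁻ p x v∈ in
      ≤∧≢⇒< (s≤s⁻¹ (f< v∈p)) λ fv≡m → v≢x (inj v∈p x∈ (trans fv≡m (sym fx≡m))))
    (λ u∈ v∈ → inj (proj₁ (∈[]≔outside⁻ p x u∈)) (proj₁ (∈[]≔outside⁻ p x v∈)))))
... | no ∄ = m≤n⇒m≤1+n (injectiveOn⇒∣p∣≤ m p f
  (λ {v} v∈ → ≤∧≢⇒< (s≤s⁻¹ (f< v∈)) λ fv≡m → ∄ (v , v∈ , fv≡m)) inj)

∣∁p∣≤m⇒n≤m+∣p∣ : ∀ {m} (p : Subset n) → ∣ ∁ p ∣ ≤ m → n ≤ m + ∣ p ∣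
∣∁p∣≤m⇒n≤m+∣p∣ {n} {m} p h =
  ≤-trans (m≤n+m∸n n ∣ p ∣)
    (≤-trans (≤-reflexive (+-comm ∣ p ∣ (n ∸ ∣ p ∣)))
      (+-monoˡ-≤ ∣ p ∣ (subst (_≤ m) (∣∁p∣≡n∸∣p∣ p) h)))

-- Bounds on `γir` of a single graph.

module _ (G : Graph n) where

  ∈N⁺ : ∀ {u v} → Adj G u v → v ∈ N G u
  ∈N⁺ {u} = ∈⟦⟧⁺ (adj? G u)

  ∈N⁻ : ∀ {u v} → v ∈ N G u → Adj G u v
  ∈N⁻ {u} = ∈⟦⟧⁻ (adj? G u)

  γir≤ : ∀ {D m} → IrregularDominating G D → ∣ D ∣ ≤ m → γir G ≤ m
  γir≤ {D} irr ∣D∣≤m = ≤-trans (proj₂ (γir-isLeast G) ∣ D ∣ (D , irr , refl)) ∣D∣≤m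

  ≤γir : ∀ {m} → (∀ D → IrregularDominating G D → m ≤ ∣ D ∣) → m ≤ γir G
  ≤γir bound with proj₁ (γir-isLeast G)
  ... | D , irr , ∣D∣≡γ = subst (_ ≤_) ∣D∣≡γ (bound D irr)

  γir≤n : γir G ≤ n
  γir≤n = γir≤ (⊤-irregularDominating G) (∣p∣≤n {n} ⊤)

  -- The n - |D| vertices outside D have distinct degrees into D, all lying
  -- in {1, …, |D|}.
  ⌈n/2⌉≤γir : ⌈ n /2⌉ ≤ γir G
  ⌈n/2⌉≤γir = ≤γir λ D (dom , irr) →
    let d : Fin n → ℕ
        d v = ∣ N G v ∩ D ∣

        0<d : ∀ {v} → v ∈ ∁ D → 0 < d v
        0<d {v} v∈ = let u , u∈D , vu = dom v (x∈∁p⇒x∉p v∈) in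
          subst (_≤ d v) (∣⁅x⁆∣≡1 u) (p⊆q⇒∣p∣≤∣q∣ λ x∈ →
            subst (_∈ N G v ∩ D) (sym (x∈⁅y⁆⇒x≡y u x∈)) (x∈p∩q⁺ (∈N⁺ vu , u∈D)))

        pred-d< : ∀ {v} → v ∈ ∁ D → pred (d v) < ∣ D ∣
        pred-d< {v} v∈ = subst (_≤ ∣ D ∣)
          (sym (suc-pred (d v) {{>-nonZero (0<d v∈)}})) (∣p∩q∣≤∣q∣ (N G v) D)

        pred-d-injective : ∀ {u v} → u ∈ ∁ D → v ∈ ∁ D →
                           pred (d u) ≡ pred (d v) → u ≡ v
        pred-d-injective {u} {v} u∈ v∈ eq = decidable-stable (u ≟ v) λ u≢v →
          irr u v (x∈∁p⇒x∉p u∈) (x∈∁p⇒x∉p v∈) u≢v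
            (pred-injective {{>-nonZero (0<d u∈)}} {{>-nonZero (0<d v∈)}} eq)
    in
    ≤-trans
      (⌈n/2⌉-mono (∣∁p∣≤m⇒n≤m+∣p∣ D
        (injectiveOn⇒∣p∣≤ ∣ D ∣ (∁ D) (pred ∘ d) pred-d< pred-d-injective)))
      (≤-reflexive (sym (n≡⌈n+n/2⌉ ∣ D ∣)))

  -- Only `u` lies outside `∁ ⁅ u ⁆`: its neighbour `v` dominates it, and irregularity has no pair
  -- to separate.
  edge⇒γir≤n∸1 : ∀ {u v} → Adj G u v → γir G ≤ n ∸ 1
  edge⇒γir≤n∸1 {u} {v} uv = γir≤ {D = ∁ ⁅ u ⁆} (dom , irr)
    (≤-reflexive (trans (∣∁p∣≡n∸∣p∣ ⁅ u ⁆) (cong (n ∸_) (∣⁅x⁆∣≡1 u))))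
    where
    ∉∁⇒≡ : ∀ {w} → w ∉ ∁ ⁅ u ⁆ → w ≡ u
    ∉∁⇒≡ = x∈⁅y⁆⇒x≡y u ∘ x∉∁p⇒x∈p

    dom : Dominating G (∁ ⁅ u ⁆)
    dom w w∉ with refl ← ∉∁⇒≡ w∉ =
      v , x∉p⇒x∈∁p (x≢y⇒x∉⁅y⁆ λ { refl → adj-irrefl G u uv }) , uv

    irr : ∀ w x → w ∉ ∁ ⁅ u ⁆ → x ∉ ∁ ⁅ u ⁆ → w ≢ x → _
    irr w x w∉ x∉ w≢x _ = w≢x (trans (∉∁⇒≡ w∉) (sym (∉∁⇒≡ x∉)))

  empty⇒γir≡n : IsEmpty G → γir G ≡ n
  empty⇒γir≡n empty = ≤-antisym γir≤n (≤γir λ D (dom , _) →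
    subst (_≤ ∣ D ∣) (∣⊤∣≡n n) (p⊆q⇒∣p∣≤∣q∣ {p = ⊤} λ {v} _ →
      decidable-stable (v ∈? D) λ v∉D →
        let u , _ , vu = dom v v∉D in empty v u vu))

  -- Every vertex outside `D` sees all of `D`, so two of them would have the same degree into `D`;
  -- hence at most one vertex is outside.
  complete⇒γir≡n∸1 : 2 ≤ n → IsComplete G → γir G ≡ n ∸ 1
  complete⇒γir≡n∸1 2≤n complete = ≤-antisym
    (edge⇒γir≤n∸1 (complete v₀ v₁ v₀≢v₁))
    (≤γir λ D (_ , irr) → ∸-monoˡ-≤ 1 (∣∁p∣≤m⇒n≤m+∣p∣ D
      -- Pigeonhole with a single value: injectivity of a constant function says that any two
      -- outside vertices coincide.
      (injectiveOn⇒∣p∣≤ 1 (∁ D) (const 0) (λ _ → s≤s z≤n) λ {u} {v} u∈ v∈ _ →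
        let u∉D = x∈∁p⇒x∉p u∈ ; v∉D = x∈∁p⇒x∉p v∈ in
        decidable-stable (u ≟ v) λ u≢v →
          irr u v u∉D v∉D u≢v (trans (full u∉D) (sym (full v∉D))))))
    where
    v₀ v₁ : Fin n
    v₀ = fromℕ< (≤-trans (s≤s z≤n) 2≤n)
    v₁ = fromℕ< 2≤n

    v₀≢v₁ : v₀ ≢ v₁
    v₀≢v₁ eq = contradiction
      (trans (sym (toℕ-fromℕ< _)) (trans (cong toℕ eq) (toℕ-fromℕ< 2≤n))) λ ()

    full : ∀ {D v} → v ∉ D → ∣ N G v ∩ D ∣ ≡ ∣ D ∣
    full {D} {v} v∉D = ≤-antisym (∣p∩q∣≤∣q∣ (N G v) D) (p⊆q⇒∣p∣≤∣q∣ λ {w} w∈D →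
      x∈p∩q⁺ (∈N⁺ (complete v w λ { refl → v∉D w∈D }) , w∈D))

  strictly-nested : ∀ {D u v} →
    (∀ {w} → w ∈ D → Adj G u w → Adj G v w) →
    (∃ λ w → w ∈ D × Adj G v w × ¬ Adj G u w) →
    ∣ N G u ∩ D ∣ < ∣ N G v ∩ D ∣
  strictly-nested {D} {u} {v} sub (w , w∈D , vw , ¬uw) = p⊂q⇒∣p∣<∣q∣
    ( (λ x∈ → let x∈N , x∈D = x∈p∩q⁻ (N G u) D x∈ in
         x∈p∩q⁺ (∈N⁺ (sub x∈D (∈N⁻ x∈N)) , x∈D))
    , w , x∈p∩q⁺ (∈N⁺ vw , w∈D) , λ w∈ → ¬uw (∈N⁻ (proj₁ (x∈p∩q⁻ (N G u) D w∈))))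

  -- By symmetry of `≢`, vertices need only be compared in increasing label order, the order in
  -- which the chains of neighbourhoods are built.
  irregular-from-< : ∀ {D} →
    (∀ {u v} → u ∉ D → v ∉ D → toℕ u < toℕ v → ∣ N G u ∩ D ∣ ≢ ∣ N G v ∩ D ∣) →
    ∀ u v → u ∉ D → v ∉ D → u ≢ v → ∣ N G u ∩ D ∣ ≢ ∣ N G v ∩ D ∣
  irregular-from-< h u v u∉ v∉ u≢v with <-cmp (toℕ u) (toℕ v)
  ... | tri< u<v _ _ = h u∉ v∉ u<v
  ... | tri≈ _ u≡v _ = contradiction (toℕ-injective u≡v) u≢v
  ... | tri> _ _ v<u = h v∉ u∉ v<u ∘ sym

-- Upper bounds and their equality cases.

empty? : (G : Graph n) → IsEmpty G ⊎ ∃ λ u → ∃ (Adj G u)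
empty? G with any? (λ u → any? (adj? G u))
... | yes edge = inj₂ edge
... | no ∄     = inj₁ λ u v uv → ∄ (u , v , uv)

complete-complement : (G : Graph n) → IsEmpty G → IsComplete (complement G)
complete-complement G empty u v u≢v = u≢v , empty u v

empty-complement : (G : Graph n) → IsComplete G → IsEmpty (complement G)
empty-complement G complete u v (u≢v , ¬uv) = ¬uv (complete u v u≢v)

complement-empty⇒complete : (G : Graph n) → IsEmpty (complement G) → IsComplete G
complement-empty⇒complete G empty u v u≢v =
  decidable-stable (adj? G u v) λ ¬uv → empty u v (u≢v , ¬uv)

-- The values for an empty or complete graph and its complement, detached from the graphs so that
-- sum and product become pure arithmetic.
data GammaPair (n a b : ℕ) : Set where
  empty-like    : a ≡ n → b ≡ n ∸ 1 → GammaPair n a b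
  complete-like : a ≡ n ∸ 1 → b ≡ n → GammaPair n a b

trivial⇒pair : (G : Graph n) → 2 ≤ n → IsEmpty G ⊎ IsComplete G →
  GammaPair n (γir G) (γir (complement G))
trivial⇒pair G 2≤n (inj₁ e) = empty-like (empty⇒γir≡n G e)
  (complete⇒γir≡n∸1 (complement G) 2≤n (complete-complement G e))
trivial⇒pair G 2≤n (inj₂ c) = complete-like (complete⇒γir≡n∸1 G 2≤n c)
  (empty⇒γir≡n (complement G) (empty-complement G c))

-- If both `G` and its complement have an edge, the edge bound applies to each. This dichotomy
-- yields the upper bounds and also decides when they are attained.
trivial-or-small : (G : Graph n) → (IsEmpty G ⊎ IsComplete G) ⊎
  (γir G ≤ n ∸ 1 × γir (complement G) ≤ n ∸ 1)
trivial-or-small G with empty? G | empty? (complement G)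
... | inj₁ e | _      = inj₁ (inj₁ e)
... | inj₂ _ | inj₁ e = inj₁ (inj₂ (complement-empty⇒complete G e))
... | inj₂ (_ , _ , uv) | inj₂ (_ , _ , ūv̄) =
  inj₂ (edge⇒γir≤n∸1 G uv , edge⇒γir≤n∸1 (complement G) ūv̄)

pair⇒sum : ∀ {a b} → 2 ≤ n → GammaPair n a b → a + b ≡ 2 * n ∸ 1
pair⇒sum {suc p} _ (empty-like refl refl)    =
  trans (sym (+-suc p p)) (cong (λ x → p + suc x) (sym (+-identityʳ p)))
pair⇒sum {suc p} _ (complete-like refl refl) =
  cong (λ x → p + suc x) (sym (+-identityʳ p))

pair⇒product : ∀ {a b} → GammaPair n a b → a * b ≡ n * (n ∸ 1)
pair⇒product         (empty-like refl refl)    = refl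
pair⇒product {n = n} (complete-like refl refl) = *-comm (n ∸ 1) n

small⇒sum< : ∀ {a b} → 2 ≤ n → a ≤ n ∸ 1 → b ≤ n ∸ 1 → a + b < 2 * n ∸ 1
small⇒sum< {suc p} 2≤n a≤ b≤ = <-≤-trans (s≤s (+-mono-≤ a≤ b≤))
  (≤-reflexive (pair⇒sum 2≤n (empty-like refl refl)))

small⇒product< : ∀ {a b} → 2 ≤ n → a ≤ n ∸ 1 → b ≤ n ∸ 1 → a * b < n * (n ∸ 1)
-- With n = p + 1, p * p falls short of (p + 1) * p by p, which is positive because 2 ≤ n.
small⇒product< {suc p} (s≤s 1≤p) a≤ b≤ =
  ≤-<-trans (*-mono-≤ a≤ b≤) (m<n+m (p * p) 1≤p)

-- The graph on {0, …, n-1} with u ~ v iff u + v < 2(l+1) and u + v ≠ l attains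
-- the lower bounds: {0, …, l} is irregular dominating for it, and {1, …, l+1}
-- for its complement.  Excluding u + v = l is what makes the vertex 0, otherwise
-- isolated in the complement, adjacent there to l.
module Balanced (l : ℕ) (1≤l : 1 ≤ l) (l<n : l < n) (n≤2k : n ≤ suc l + suc l) where

  k : ℕ
  k = suc l

  balanced : Graph n
  balanced = record
    { Adj        = λ u v → u ≢ v × toℕ u + toℕ v < k + k × toℕ u + toℕ v ≢ l
    ; adj?       = λ u v → ¬? (u ≟ v) ×-dec (_ <? _) ×-dec ¬? (_ ℕ.≟ _)
    ; adj-sym    = λ {u} {v} (u≢v , lt , ne) →
        u≢v ∘ sym
        , subst (_< k + k) (+-comm (toℕ u) (toℕ v)) lt
        , subst (_≢ l) (+-comm (toℕ u) (toℕ v)) ne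
    ; adj-irrefl = λ v (v≢v , _) → v≢v refl
    }

  <⇒≢-Fin : {u v : Fin n} → toℕ u < toℕ v → u ≢ v
  <⇒≢-Fin u<v refl = <-irrefl refl u<v

  co-adj⁺ : ∀ {u v} → u ≢ v → k + k ≤ toℕ u + toℕ v ⊎ toℕ u + toℕ v ≡ l →
            Adj (complement balanced) u v
  co-adj⁺ u≢v h = u≢v , λ (_ , lt , ne) → [ <⇒≱ lt , ne ]′ h

  co-adj⁻ : ∀ {u v} → Adj (complement balanced) u v →
            k + k ≤ toℕ u + toℕ v ⊎ toℕ u + toℕ v ≡ l
  co-adj⁻ {u} {v} (u≢v , ¬uv) with toℕ u + toℕ v <? k + k | toℕ u + toℕ v ℕ.≟ l
  ... | no ≮  | _     = inj₁ (≮⇒≥ ≮)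
  ... | yes _ | yes e = inj₂ e
  ... | yes < | no ne = contradiction (u≢v , < , ne) ¬uv

  toℕ<2k : (v : Fin n) → toℕ v < k + k
  toℕ<2k v = <-≤-trans (toℕ<n v) n≤2k

  vertex : ∀ {i} → i < n → ∃ λ (v : Fin n) → toℕ v ≡ i
  vertex i<n = fromℕ< i<n , toℕ-fromℕ< i<n

  -- The vertex w with v + w = 2k separates v from the smaller vertices.
  partner : ∀ v → k < toℕ v → ∃ λ w → toℕ v + toℕ w ≡ k + k × 1 ≤ toℕ w × toℕ w < k
  partner v k<v =
    let w<k = +-cancelˡ-< k _ _ (<-≤-trans (+-monoˡ-< (k + k ∸ toℕ v) k<v)
                (≤-reflexive (m+[n∸m]≡n (<⇒≤ (toℕ<2k v)))))
        w , w≡ = vertex (≤-trans w<k l<n)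
    in w , trans (cong (toℕ v +_) w≡) (m+[n∸m]≡n (<⇒≤ (toℕ<2k v)))
         , subst (1 ≤_) (sym w≡) (m<n⇒0<n∸m (toℕ<2k v))
         , subst (_< k) (sym w≡) w<k

  -- The set {0, ..., l} in the balanced graph.

  inD? : Decidable {A = Fin n} λ v → toℕ v < k
  inD? v = toℕ v <? k

  D : Subset n
  D = ⟦ inD? ⟧

  ∣D∣≤k : ∣ D ∣ ≤ k
  ∣D∣≤k = injectiveOn⇒∣p∣≤ k D toℕ (∈⟦⟧⁻ inD?) (λ _ _ → toℕ-injective)

  -- A vertex v ≥ k has as neighbours in `D` exactly the w < 2k - v, since v + w ≥ k > l makes the
  -- excluded sum irrelevant. These sets shrink as v grows, and all contain 0.
  D-irregularDominating : IrregularDominating balanced D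
  D-irregularDominating = dom , irregular-from-< balanced λ u∉ v∉ u<v → >⇒≢ (nested u∉ v∉ u<v)
    where
    ≥k : ∀ {v} → v ∉ D → k ≤ toℕ v
    ≥k v∉ = ≮⇒≥ (v∉ ∘ ∈⟦⟧⁺ inD?)

    dom : Dominating balanced D
    dom v v∉ =
      let w , w≡0 = vertex (≤-trans (s≤s z≤n) l<n)
          w<k = subst (_< k) (sym w≡0) (s≤s z≤n)
          v+w≡v = trans (cong (toℕ v +_) w≡0) (+-identityʳ _)
      in w , ∈⟦⟧⁺ inD? w<k
           , <⇒≢-Fin (<-≤-trans w<k (≥k v∉)) ∘ sym
           , subst (_< k + k) (sym v+w≡v) (toℕ<2k v)
           , λ e → <⇒≢ (≥k v∉) (sym (trans (sym v+w≡v) e))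

    nested : ∀ {u v} → u ∉ D → v ∉ D → toℕ u < toℕ v →
             ∣ N balanced v ∩ D ∣ < ∣ N balanced u ∩ D ∣
    nested {u} {v} u∉ v∉ u<v = strictly-nested balanced
      (λ {w} w∈ (_ , lt , _) → adj w∈ (<-trans (+-monoˡ-< (toℕ w) u<v) lt))
      -- The sum v + w = 2k just fails the adjacency condition, while u + w is smaller and meets it.
      (let w , v+w≡ , _ , w<k = partner v (≤-<-trans (≥k u∉) u<v)
           w∈ = ∈⟦⟧⁺ inD? w<k
       in w , w∈ , adj w∈ (<-≤-trans (+-monoˡ-< (toℕ w) u<v) (≤-reflexive v+w≡))
            , λ (_ , lt , _) → <-irrefl v+w≡ lt)
      where
      adj : ∀ {w} → w ∈ D → toℕ u + toℕ w < k + k → Adj balanced u w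
      adj w∈ lt = <⇒≢-Fin (<-≤-trans (∈⟦⟧⁻ inD? w∈) (≥k u∉)) ∘ sym
                , lt , >⇒≢ (m≤n⇒m≤n+o _ (≥k u∉))

  -- The set {1, ..., l+1} in the complement.

  inD′? : Decidable {A = Fin n} λ v → 1 ≤ toℕ v × toℕ v ≤ k
  inD′? v = (1 ≤? toℕ v) ×-dec (toℕ v ≤? k)

  D′ : Subset n
  D′ = ⟦ inD′? ⟧

  ∣D′∣≤k : ∣ D′ ∣ ≤ k
  -- The labels 1, ..., k are shifted down to 0, ..., k - 1, injectively because they are positive.
  ∣D′∣≤k = injectiveOn⇒∣p∣≤ k D′ (pred ∘ toℕ)
    (λ v∈ → let 1≤v , v≤k = ∈⟦⟧⁻ inD′? v∈ in
      subst (_≤ k) (sym (suc-pred _ {{>-nonZero 1≤v}})) v≤k)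
    (λ u∈ v∈ → toℕ-injective ∘
      pred-injective {{>-nonZero (proj₁ (∈⟦⟧⁻ inD′? u∈))}}
                     {{>-nonZero (proj₁ (∈⟦⟧⁻ inD′? v∈))}})

  -- Outside `D′` lie 0, whose only neighbour there is l, and the vertices v > k, whose neighbours
  -- there are the w ≥ 2k - v. The latter sets grow with v and always contain both l and k, so the
  -- set {l} of vertex 0 is the bottom of the chain.
  D′-irregularDominating : IrregularDominating (complement balanced) D′
  D′-irregularDominating =
    dom , irregular-from-< (complement balanced) λ u∉ v∉ u<v → <⇒≢ (nested u∉ v∉ u<v)
    where
    split : ∀ {v} → v ∉ D′ → toℕ v ≡ 0 ⊎ k < toℕ v
    split {v} v∉ with 1 ≤? toℕ v
    ... | yes 1≤v = inj₂ (≰⇒> λ v≤k → v∉ (∈⟦⟧⁺ inD′? (1≤v , v≤k)))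
    ... | no ≱    = inj₁ (n<1⇒n≡0 (≰⇒> ≱))

    vertex-l : ∃ λ (v : Fin n) → toℕ v ≡ l
    vertex-l = vertex l<n

    l∈D′ : proj₁ vertex-l ∈ D′
    l∈D′ = ∈⟦⟧⁺ inD′? (subst (λ i → 1 ≤ i × i ≤ k) (sym (proj₂ vertex-l)) (1≤l , n≤1+n l))

    -- The hypotheses allow n = k, so the label k is known to occur only once a larger label does.
    vertex-k : ∀ {v : Fin n} → k < toℕ v → ∃ λ (w : Fin n) → toℕ w ≡ k
    vertex-k {v} k<v = vertex (<-trans k<v (toℕ<n v))

    k∈D′ : ∀ {w} → toℕ w ≡ k → w ∈ D′
    k∈D′ w≡k = ∈⟦⟧⁺ inD′? (subst (λ i → 1 ≤ i × i ≤ k) (sym w≡k) (s≤s z≤n , ≤-refl))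

    adj-high : ∀ {v w} → k < toℕ v → w ∈ D′ → k + k ≤ toℕ v + toℕ w →
               Adj (complement balanced) v w
    adj-high k<v w∈ le =
      co-adj⁺ (<⇒≢-Fin (≤-<-trans (proj₂ (∈⟦⟧⁻ inD′? w∈)) k<v) ∘ sym) (inj₁ le)

    adj-k : ∀ {v w} → k < toℕ v → toℕ w ≡ k → Adj (complement balanced) v w
    adj-k k<v w≡k = adj-high k<v (k∈D′ w≡k) (+-mono-≤ (<⇒≤ k<v) (≤-reflexive (sym w≡k)))

    dom : Dominating (complement balanced) D′
    dom v v∉ with split v∉
    ... | inj₁ v≡0 = proj₁ vertex-l , l∈D′
        , co-adj⁺ (<⇒≢-Fin (subst₂ _<_ (sym v≡0) (sym (proj₂ vertex-l)) 1≤l))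
            (inj₂ (cong₂ _+_ v≡0 (proj₂ vertex-l)))
    ... | inj₂ k<v = let w , w≡k = vertex-k k<v in w , k∈D′ w≡k , adj-k k<v w≡k

    nested : ∀ {u v} → u ∉ D′ → v ∉ D′ → toℕ u < toℕ v →
             ∣ N (complement balanced) u ∩ D′ ∣ < ∣ N (complement balanced) v ∩ D′ ∣
    nested {u} {v} u∉ v∉ u<v with split u∉ | split v∉
    ... | _ | inj₁ v≡0 = contradiction (subst (toℕ u <_) v≡0 u<v) λ ()
    ... | inj₁ u≡0 | inj₂ k<v = strictly-nested (complement balanced)
      -- Here w has label l, and v ≥ k + 1 gives v + l ≥ k + 1 + l = 2k.
      (λ {w} w∈ uw → adj-high k<v w∈
        (subst (λ i → k + k ≤ toℕ v + i) (sym (only-l w uw))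
          (≤-trans (≤-reflexive (+-suc k l)) (+-monoˡ-≤ l k<v))))
      (let w , w≡k = vertex-k k<v
       in w , k∈D′ w≡k , adj-k k<v w≡k
            , λ uw → 1+n≢n (trans (sym w≡k) (only-l w uw)))
      where
      only-l : ∀ w → Adj (complement balanced) u w → toℕ w ≡ l
      only-l w uw with co-adj⁻ {u} {w} uw
      ... | inj₁ le = contradiction (subst (λ i → k + k ≤ i + toℕ w) u≡0 le)
                        (<⇒≱ (toℕ<2k w))
      ... | inj₂ e  = subst (λ i → i + toℕ w ≡ l) u≡0 e
    ... | inj₂ k<u | inj₂ k<v = strictly-nested (complement balanced)
      (λ {w} w∈ uw → adj-high k<v w∈
        (≤-trans (≥2k w uw) (+-monoˡ-≤ (toℕ w) (<⇒≤ u<v))))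
      -- The bound 1 ≤ w keeps the partner in `D′`, which omits 0.
      (let w , v+w≡ , 1≤w , w<k = partner v k<v
           w∈ = ∈⟦⟧⁺ inD′? (1≤w , <⇒≤ w<k)
       in w , w∈ , adj-high k<v w∈ (≤-reflexive (sym v+w≡))
            , λ uw → <⇒≱ (<-≤-trans (+-monoˡ-< (toℕ w) u<v) (≤-reflexive v+w≡)) (≥2k w uw))
      where
      ≥2k : ∀ w → Adj (complement balanced) u w → k + k ≤ toℕ u + toℕ w
      ≥2k w uw with co-adj⁻ {u} {w} uw
      ... | inj₁ le = le
      ... | inj₂ e  = contradiction e (>⇒≢ (m≤n⇒m≤n+o _ (<⇒≤ k<u)))

balanced-attains : ∀ n → 3 ≤ n → Σ (Graph n) λ G →
  γir G ≡ ⌈ n /2⌉ × γir (complement G) ≡ ⌈ n /2⌉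
balanced-attains n@(suc (suc m@(suc _))) (s≤s (s≤s (s≤s _))) = balanced
  , ≤-antisym (γir≤ balanced D-irregularDominating ∣D∣≤k) (⌈n/2⌉≤γir balanced)
  , ≤-antisym (γir≤ (complement balanced) D′-irregularDominating ∣D′∣≤k)
              (⌈n/2⌉≤γir (complement balanced))
  where
  -- With n = m + 2, `suc ⌈ m /2⌉` computes to `⌈ n /2⌉`, so k is the required size; n ≥ 3 makes m,
  -- and hence l, positive.
  open Balanced {n} ⌈ m /2⌉ (s≤s z≤n) (<-trans (s≤s (⌈n/2⌉≤n m)) ≤-refl)
    (subst (_≤ ⌈ n /2⌉ + ⌈ n /2⌉) (⌊n/2⌋+⌈n/2⌉≡n n) (+-monoˡ-≤ ⌈ n /2⌉ (⌊n/2⌋≤⌈n/2⌉ n)))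

emptyGraph : ∀ n → Graph n
emptyGraph n = record
  { Adj = λ _ _ → Empty.⊥ ; adj? = λ _ _ → no id ; adj-sym = id ; adj-irrefl = λ _ → id }

theorem6p2 :
  (∀ (n : ℕ) → 2 ≤ n → (G : Graph n) →
    (2 * ⌈ n /2⌉ ≤ γir G + γir (complement G) ×
     γir G + γir (complement G) ≤ 2 * n ∸ 1) ×
    (⌈ n /2⌉ ^ 2 ≤ γir G * γir (complement G) ×
     γir G * γir (complement G) ≤ n * (n ∸ 1)))
  ×
  (∀ (n : ℕ) → 3 ≤ n →
    (Σ (Graph n) λ G → γir G + γir (complement G) ≡ 2 * ⌈ n /2⌉) ×
    (Σ (Graph n) λ G → γir G + γir (complement G) ≡ 2 * n ∸ 1) ×
    (Σ (Graph n) λ G → γir G * γir (complement G) ≡ ⌈ n /2⌉ ^ 2) ×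
    (Σ (Graph n) λ G → γir G * γir (complement G) ≡ n * (n ∸ 1)))
  ×
  (∀ (n : ℕ) → 2 ≤ n → (G : Graph n) →
    ((γir G + γir (complement G) ≡ 2 * n ∸ 1) ⇔ (IsEmpty G ⊎ IsComplete G)) ×
    ((γir G * γir (complement G) ≡ n * (n ∸ 1)) ⇔ (IsEmpty G ⊎ IsComplete G)))
theorem6p2 = bounds , attained , λ n 2≤n G → sum-eq n 2≤n G , product-eq n 2≤n G
  where
  double : ∀ a → a + a ≡ 2 * a
  double a = cong (a +_) (sym (+-identityʳ a))

  square : ∀ a → a * a ≡ a ^ 2
  square a = cong (a *_) (sym (*-identityʳ a))

  bounds : ∀ n → 2 ≤ n → (G : Graph n) → _
  bounds n 2≤n G =
    ( ≤-trans (≤-reflexive (sym (double ⌈ n /2⌉)))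
        (+-mono-≤ (⌈n/2⌉≤γir G) (⌈n/2⌉≤γir (complement G)))
    , [ ≤-reflexive ∘ pair⇒sum 2≤n ∘ trivial⇒pair G 2≤n
      , (λ (a , b) → <⇒≤ (small⇒sum< 2≤n a b)) ]′ (trivial-or-small G)
    ) ,
    ( ≤-trans (≤-reflexive (sym (square ⌈ n /2⌉)))
        (*-mono-≤ (⌈n/2⌉≤γir G) (⌈n/2⌉≤γir (complement G)))
    , [ ≤-reflexive ∘ pair⇒product ∘ trivial⇒pair G 2≤n
      , (λ (a , b) → <⇒≤ (small⇒product< 2≤n a b)) ]′ (trivial-or-small G)
    )

  attained : ∀ n → 3 ≤ n → _
  attained n 3≤n =
    let G , γ≡ , γ̄≡ = balanced-attains n 3≤n
        2≤n = ≤-trans (n≤1+n 2) 3≤n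
        pair = trivial⇒pair (emptyGraph n) 2≤n (inj₁ λ _ _ → id)
    in (G , trans (cong₂ _+_ γ≡ γ̄≡) (double ⌈ n /2⌉))
     , (emptyGraph n , pair⇒sum 2≤n pair)
     , (G , trans (cong₂ _*_ γ≡ γ̄≡) (square ⌈ n /2⌉))
     , (emptyGraph n , pair⇒product pair)

  sum-eq : ∀ n → 2 ≤ n → (G : Graph n) →
    (γir G + γir (complement G) ≡ 2 * n ∸ 1) ⇔ (IsEmpty G ⊎ IsComplete G)
  sum-eq n 2≤n G = mk⇔
    -- Equality excludes the case where both numbers are at most n - 1, since there the sum is
    -- strictly smaller.
    (λ e → [ id , (λ (a , b) → contradiction e (<⇒≢ (small⇒sum< 2≤n a b))) ]′
      (trivial-or-small G))
    (pair⇒sum 2≤n ∘ trivial⇒pair G 2≤n)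

  product-eq : ∀ n → 2 ≤ n → (G : Graph n) →
    (γir G * γir (complement G) ≡ n * (n ∸ 1)) ⇔ (IsEmpty G ⊎ IsComplete G)
  product-eq n 2≤n G = mk⇔
    (λ e → [ id , (λ (a , b) → contradiction e (<⇒≢ (small⇒product< 2≤n a b))) ]′
      (trivial-or-small G))
    (pair⇒product ∘ trivial⇒pair G 2≤n)
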